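{- Let $\mathit{Airplane} = \big((\mathit{Eng}_{\mathrm{L}} \uplus \mathit{Eng}_{\mathrm{R}}) \parallel \mathit{Check}\big)\setminus\{\mathit{warning}\}$ and $\overline{\mathit{Airplane}} = \big((\overline{\mathit{Eng}_{\mathrm{L}}} \uplus \overline{\mathit{Eng}_{\mathrm{R}}}) \parallel \mathit{Check}\big)\setminus\{\mathit{warning}\}$, with components as defined in the context. Then $\mathit{Airplane} \approx \overline{\mathit{Airplane}}$.
   Context: **Names and values.** There are sets of state variables $\mathcal{X}$, channels $\mathcal{C}$, actuators $\mathcal{A}$ and sensors $\mathcal{S}$. Values $v$ are built from basic values (Booleans, integers, real numbers) and also include names. For a set of names $\mathcal{N}$, $\mathbb{R}^{\mathcal{N}}$ is the set of functions $\mathcal{N}\to\mathbb{R}$, ordered pointwise; $\xi[n\mapsto v]$ is $\xi$ updated at $n$ to $v$. **Physical environment.** Given $\hat{\mathcal{X}}\subseteq\mathcal{X}$, $\hat{\mathcal{A}}\subseteq\mathcal{A}$, $\hat{\mathcal{S}}\subseteq\mathcal{S}$, a physical environment is a 7-tuple $E=\langle \xi_x,\xi_u,\xi_w,\mathit{evol},\xi_e,\mathit{meas},\mathit{inv}\rangle$ of total functions: state function $\xi_x\in\mathbb{R}^{\hat{\mathcal{X}}}$, actuator function $\xi_u\in\mathbb{R}^{\hat{\mathcal{A}}}$, uncertainty function $\xi_w\in\mathbb{R}^{\hat{\mathcal{X}}}$, evolution map $\mathit{evol}:\mathbb{R}^{\hat{\mathcal{X}}}\times\mathbb{R}^{\hat{\mathcal{A}}}\times\mathbb{R}^{\hat{\mathcal{X}}}\to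 2^{\mathbb{R}^{\hat{\mathcal{X}}}}$, sensor-error function $\xi_e\in\mathbb{R}^{\hat{\mathcal{S}}}$, measurement map $\mathit{meas}:\mathbb{R}^{\hat{\mathcal{X}}}\times\mathbb{R}^{\hat{\mathcal{S}}}\to 2^{\mathbb{R}^{\hat{\mathcal{S}}}}$, invariant function $\mathit{inv}:\mathbb{R}^{\hat{\mathcal{X}}}\to\{\mathsf{true},\mathsf{false}\}$. Operators: $\mathit{read\_sensor}(E,s)=\{\xi(s):\xi\in\mathit{meas}(\xi_x,\xi_e)\}$; $\mathit{update\_act}(E,a,v)$ is $E$ with $\xi_u$ replaced by $\xi_u[a\mapsto v]$; $\mathit{next}(E)$ is the set of environments obtained from $E$ by replacing $\xi_x$ with some $\xi\in\mathit{evol}(\xi_x,\xi_u,\xi_w)$; $\mathit{inv}(E)=\mathit{inv}(\xi_x)$. **Processes.** $P,Q ::= \mathsf{nil} \mid \mathsf{tick}.P \mid P\parallel Q \mid \lfloor\pi.P\rfloor Q \mid \mathsf{if}\,(b)\,\{P\}\,\mathsf{else}\,\{Q\} \mid P\setminus c \mid X \mid \mathsf{fix}\,X.P$, with prefixes $\pi$ among: $\overline{c}\langle v\rangle$ (send $v$ on channel $c$), $c(x)$ (receive on $c$), $\mathsf{read}\,s(x)$ (read sensor $s$), $\mathsf{write}\,a\langle v\rangle$ (write $v$ on actuator $a$). The variable $x$ is bound in $\lfloor c(x).P\rfloor Q$ and $\lfloor\mathsf{read}\,s(x).P\rfloor Q$ (with scope $P$), and $X$ is bound in $\mathsf{fix}\,X.P$;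 processes are taken up to $\alpha$-conversion and are closed (no free variables or process variables). In $\mathsf{tick}.Q$ and $\lfloor\pi.P\rfloor Q$ the occurrence of $Q$ is time-guarded; in $\mathsf{fix}\,X.P$ all occurrences of $X$ in $P$ must be time-guarded. Guards $b$ are decidable, and $\mathsf{if}\,(b)\,\{P\}\,\mathsf{else}\,\{Q\}$ is identified with $P$ if $b$ is true and with $Q$ if $b$ is false. $T\{v/x\}$ and $T\{P/X\}$ denote substitution. Abbreviations: $\pi.P$ stands for $\mathsf{fix}\,X.\lfloor\pi.P\rfloor X$ with $X$ not in $P$; $\mathsf{tick}^k.P$ is $k$ consecutive $\mathsf{tick}$ prefixes followed by $P$; $\overline{c}$ is an output on $c$ used for pure synchronisation (no value); $P\setminus\{c_1,\dots,c_n\}=P\setminus c_1\cdots\setminus c_n$. **Process transitions** $P\xrightarrow{\lambda}P'$, $\lambda\in\{\mathsf{tick},\tau,\overline{c}v,cv,a!v,s?v\}$, are the least relation such that: $\lfloor\overline{c}\langle v\rangle.P\rfloor Q\xrightarrow{\overline{c}v}P$; $\lfloor c(x).P\rfloor Q\xrightarrow{cv}P\{v/x\}$; $\lfloor\mathsf{write}\,a\langle v\rangle.P\rfloor Q\xrightarrow{a!v}P$; $\lfloor\mathsf{read}\,s(x).P\rfloor Q\xrightarrow{s?v}P\{v/x\}$; if $P\xrightarrow{\overline{c}v}P'$ and $Q\xrightarrow{cv}Q'$ then $P\parallel Q\xrightarrow{\tau}P'\parallel Q'$ (and symmetrically); if $P\xrightarrow{\lambda}P'$ and $\lambda\ne\mathsf{tick}$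 then $P\parallel Q\xrightarrow{\lambda}P'\parallel Q$ (and symmetrically); if $P\xrightarrow{\lambda}P'$ and $\lambda\notin\{cv,\overline{c}v\}$ then $P\setminus c\xrightarrow{\lambda}P'\setminus c$; if $P\{\mathsf{fix}\,X.P/X\}\xrightarrow{\lambda}Q$ then $\mathsf{fix}\,X.P\xrightarrow{\lambda}Q$; $\mathsf{nil}\xrightarrow{\mathsf{tick}}\mathsf{nil}$; $\mathsf{tick}.P\xrightarrow{\mathsf{tick}}P$; $\lfloor\pi.P\rfloor Q\xrightarrow{\mathsf{tick}}Q$; if $P\xrightarrow{\mathsf{tick}}P'$, $Q\xrightarrow{\mathsf{tick}}Q'$ and $P\parallel Q$ has no $\tau$-transition then $P\parallel Q\xrightarrow{\mathsf{tick}}P'\parallel Q'$. **CPSs.** A CPS is $M=E\Join P$, always assumed well-formed: every sensor $s$ mentioned in $P$ is in the domain of $\xi_e$ and every actuator $a$ mentioned in $P$ is in the domain of $\xi_u$. CPSs are identified up to renaming of state variables, sensor names and actuator names. Transitions $M\xrightarrow{\alpha}M'$, $\alpha\in\{\tau,\overline{c}v,cv,\mathsf{tick}\}$, all requiring $\mathit{inv}(E)=\mathsf{true}$: - $E\Join P\xrightarrow{\overline{c}v}E\Join P'$ if $P\xrightarrow{\overline{c}v}P'$; $E\Join P\xrightarrow{cv}E\Join P'$ if $P\xrightarrow{cv}P'$; - (SensRead) $E\Join P\xrightarrow{\tau}E\Join P'$ if $P\xrightarrow{s?v}P'$ and $v\in\mathit{read\_sensor}(E,s)$; - (ActWrite)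 $E\Join P\xrightarrow{\tau}\mathit{update\_act}(E,a,v)\Join P'$ if $P\xrightarrow{a!v}P'$; - (Tau) $E\Join P\xrightarrow{\tau}E\Join P'$ if $P\xrightarrow{\tau}P'$; - (Time) $E\Join P\xrightarrow{\mathsf{tick}}E'\Join P'$ if $P\xrightarrow{\mathsf{tick}}P'$, $E\Join P$ has no $\tau$-transition, and $E'\in\mathit{next}(E)$. For $M=E\Join P$: $M\parallel Q$ is $E\Join(P\parallel Q)$ and $M\setminus c$ is $E\Join(P\setminus c)$. **Bisimilarity.** $\Rightarrow$ is the reflexive-transitive closure of $\xrightarrow{\tau}$; $\stackrel{\alpha}{\Rightarrow}$ is $\Rightarrow\xrightarrow{\alpha}\Rightarrow$; $\stackrel{\hat\alpha}{\Rightarrow}$ is $\Rightarrow$ if $\alpha=\tau$ and $\stackrel{\alpha}{\Rightarrow}$ otherwise. A symmetric relation $\mathcal{R}$ on CPSs is a bisimulation if $M\,\mathcal{R}\,N$ and $M\xrightarrow{\alpha}M'$ imply that there is $N'$ with $N\stackrel{\hat\alpha}{\Rightarrow}N'$ and $M'\,\mathcal{R}\,N'$. $M\approx N$ iff $M\,\mathcal{R}\,N$ for some bisimulation $\mathcal{R}$. **Disjoint union.** Let $E_i=\langle \xi_x^i,\xi_u^i,\xi_w^i,\mathit{evol}^i,\xi_e^i,\mathit{meas}^i,\mathit{inv}^i\rangle$, $i\in\{1,2\}$, have disjoint sets of state variables $\hat{\mathcal{X}}_i$, actuators $\hat{\mathcal{A}}_i$ and sensors $\hat{\mathcal{S}}_i$.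 For functions with disjoint domains, $\xi_1\uplus\xi_2$ is their union; $\xi|_{\mathcal{M}}$ is restriction. $E_1\uplus E_2$ has components $\xi_x^1\uplus\xi_x^2$, $\xi_u^1\uplus\xi_u^2$, $\xi_w^1\uplus\xi_w^2$, $\xi_e^1\uplus\xi_e^2$, and $\mathit{evol}(\xi,\psi,\phi)=\{\xi_1\uplus\xi_2:\xi_i\in\mathit{evol}^i(\xi|_{\hat{\mathcal{X}}_i},\psi|_{\hat{\mathcal{A}}_i},\phi|_{\hat{\mathcal{X}}_i}),\,i=1,2\}$, $\mathit{meas}(\xi,\psi)=\{\xi_1\uplus\xi_2:\xi_i\in\mathit{meas}^i(\xi|_{\hat{\mathcal{X}}_i},\psi|_{\hat{\mathcal{S}}_i}),\,i=1,2\}$, $\mathit{inv}(\xi)=\mathit{inv}^1(\xi|_{\hat{\mathcal{X}}_1})\wedge\mathit{inv}^2(\xi|_{\hat{\mathcal{X}}_2})$. For $M_i=E_i\Join P_i$, $M_1\uplus M_2=(E_1\uplus E_2)\Join(P_1\parallel P_2)$. **The engine.** $\mathit{Env}=\langle \xi_x,\xi_u,\xi_w,\mathit{evol},\xi_e,\mathit{meas},\mathit{inv}\rangle$ has one state variable $\mathit{temp}$, one actuator $\mathit{cool}$, one sensor $s_t$, and: $\xi_x(\mathit{temp})=0$; $\xi_u(\mathit{cool})=\mathsf{off}$ (actuator values are regarded as elements of $\{\mathsf{on},\mathsf{off}\}$, a real value $\ge0$ standing for $\mathsf{off}$ and $<0$ for $\mathsf{on}$); $\xi_w(\mathit{temp})=\delta=0.4$;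 $\mathit{evol}(\xi_x^i,\xi_u^i,\xi_w)=\{\xi:\xi(\mathit{temp})=\xi_x^i(\mathit{temp})+\mathit{heat}(\xi_u^i,\mathit{cool})+\gamma,\ \gamma\in[-\delta,+\delta]\}$, where $\mathit{heat}(\xi_u^i,\mathit{cool})=-1$ if $\xi_u^i(\mathit{cool})=\mathsf{on}$ and $+1$ if $\xi_u^i(\mathit{cool})=\mathsf{off}$; $\xi_e(s_t)=\epsilon=0.1$; $\mathit{meas}(\xi_x^i,\xi_e)=\{\xi:\xi(s_t)\in[\xi_x^i(\mathit{temp})-\epsilon,\xi_x^i(\mathit{temp})+\epsilon]\}$; $\mathit{inv}(\xi_x)=\mathsf{true}$ iff $0\le\xi_x(\mathit{temp})\le30$. The controller is $$\mathit{Ctrl}=\mathsf{fix}\,X.\,\mathsf{read}\,s_t(x).\,\mathsf{if}\,(x>10)\,\{\mathit{Cooling}\}\,\mathsf{else}\,\{\mathsf{tick}.X\},$$ $$\mathit{Cooling}=\mathsf{write}\,\mathit{cool}\langle\mathsf{on}\rangle.\,\mathsf{fix}\,Y.\,\mathsf{tick}^5.\,\mathsf{read}\,s_t(x).\,\mathsf{if}\,(x>10)\,\{\overline{\mathit{warning}}\langle\mathrm{ID}\rangle.Y\}\,\mathsf{else}\,\{\mathsf{write}\,\mathit{cool}\langle\mathsf{off}\rangle.\mathsf{tick}.X\},$$ where $\mathit{warning}$ is a channel and $\mathrm{ID}$ a value (the engine identifier). $\mathit{Eng}=\mathit{Env}\Join\mathit{Ctrl}$. **The variant.** $\overline{\mathit{Eng}}=\overline{\mathit{Env}}\Join\mathit{Ctrl}$,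 where $\overline{\mathit{Env}}$ is the same as $\mathit{Env}$ except that in the evolution map $\mathit{heat}(\xi_u^i,\mathit{cool})=-0.8$ if $\xi_u^i(\mathit{cool})=\mathsf{on}$. **The airplane.** $\mathit{Eng}_{\mathrm{L}}$ is $\mathit{Eng}$ with $\mathrm{ID}$, $\mathit{temp}$, $\mathit{cool}$, $s_t$ replaced by $\mathrm{L}$, $\mathit{temp\_l}$, $\mathit{cool\_l}$, $s_{t\_l}$; $\mathit{Eng}_{\mathrm{R}}$ is $\mathit{Eng}$ with $\mathrm{ID}$, $\mathit{temp}$, $\mathit{cool}$, $s_t$ replaced by $\mathrm{R}$, $\mathit{temp\_r}$, $\mathit{cool\_r}$, $s_{t\_r}$ ($\mathrm{L}\neq\mathrm{R}$, all names distinct). $\overline{\mathit{Eng}_{\mathrm{L}}}$ and $\overline{\mathit{Eng}_{\mathrm{R}}}$ are obtained from $\overline{\mathit{Eng}}$ by the same replacements. With channels $\mathit{warning},\mathit{alarm},\mathit{failure}$ and $\mathit{id}\in\{\mathrm{L},\mathrm{R}\}$, $$\mathit{Check}=\mathsf{fix}\,X.\lfloor\mathit{warning}(x).\,\mathsf{if}\,(x=\mathrm{L})\,\{\mathit{Check}_1^{\mathrm{L}}\}\,\mathsf{else}\,\{\mathit{Check}_1^{\mathrm{R}}\}\rfloor X,$$ $$\mathit{Check}_i^{\mathit{id}}=\lfloor\mathit{warning}(y).\,\mathsf{if}\,(y\neq\mathit{id})\,\{\overline{\mathit{alarm}}.\mathsf{tick}.X\}\,\mathsf{else}\,\{\mathsf{tick}.\mathit{Check}_{i+1}^{\mathit{id}}\}\rfloor\mathit{Check}_{i+1}^{\mathit{id}}\quad(1\le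 i\le4),$$ $$\mathit{Check}_5^{\mathit{id}}=\lfloor\mathit{warning}(z).\,\mathsf{if}\,(z\neq\mathit{id})\,\{\overline{\mathit{alarm}}.\mathsf{tick}.X\}\,\mathsf{else}\,\{\overline{\mathit{failure}}\langle\mathit{id}\rangle.\mathsf{tick}.X\}\rfloor\,\overline{\mathit{failure}}\langle\mathit{id}\rangle.X.$$ -}

module Defs where

open import Level using (0ℓ) renaming (suc to lsuc)
open import Algebra.Structures using (IsCommutativeRing)
open import Data.Bool.Base using (Bool; true; false; _∧_; not; T)
  renaming (if_then_else_ to ifᵇ_then_else_)
import Data.Bool.Properties as Bool
open import Data.Fin.Base using (Fin; zero; suc; lift)
import Data.Fin.Properties as Fin
open import Data.Integer.Base using (ℤ)
import Data.Integer.Properties as ℤ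
open import Data.Maybe.Base using (Maybe; just; nothing)
open import Data.Nat.Base using (ℕ; zero; suc)
open import Data.Product.Base using (∃; ∃₂; _×_; _,_; proj₁)
open import Data.Sum.Base using (_⊎_; inj₁; inj₂; [_,_])
import Data.Sum.Properties as Sum
open import Data.Unit.Base using (⊤; tt)
import Data.Unit.Properties as Unit
open import Data.Vec.Functional using (_∷_)
open import Function.Base using (id; _∘_)
open import Relation.Binary.Core using (Rel)
open import Relation.Binary.Definitions using (Decidable; DecidableEquality; Symmetric)
open import Relation.Binary.PropositionalEquality using (_≡_; _≢_; refl; sym; trans)
open import Relation.Binary.Structures using (IsStrictTotalOrder)
open import Relation.Binary.Construct.Closure.ReflexiveTransitive using (Star)
import Relation.Binary.Construct.StrictToNonStrict as StrictToNonStrict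
open import Relation.Nullary using (¬_; does; yes; no)
open import Relation.Unary using (Pred; _∈_; _∪_; _⊥_; ｛_｝)

-- The real numbers, axiomatised (categorically) as a Dedekind-complete ordered
-- field.  As in classical mathematics, the order is decidable.
record CompleteOrderedField : Set₁ where
  infix  4 _<_ _≤?_
  infixl 6 _+_ _-_
  infixl 7 _*_
  infix  8 -_ _⁻¹
  field
    ℝ       : Set
    _<_     : Rel ℝ 0ℓ
    _+_ _*_ : ℝ → ℝ → ℝ
    -_ _⁻¹  : ℝ → ℝ
    0# 1#   : ℝ

    isCommutativeRing  : IsCommutativeRing _≡_ _+_ _*_ -_ 0# 1#
    isStrictTotalOrder : IsStrictTotalOrder _≡_ _<_
    0<1                : 0# < 1#
    ⁻¹-inverse         : ∀ x → x ≢ 0# → x * x ⁻¹ ≡ 1#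
    +-monoˡ-<          : ∀ z {x y} → x < y → x + z < y + z
    *-pos              : ∀ {x y} → 0# < x → 0# < y → 0# < x * y

  open StrictToNonStrict _≡_ _<_ public using (_≤_)

  IsUpperBound : Pred ℝ 0ℓ → ℝ → Set
  IsUpperBound A b = ∀ x → x ∈ A → x ≤ b

  field
    supremum : (A : Pred ℝ 0ℓ) → ∃ A → ∃ (IsUpperBound A) →
               ∃ λ s → IsUpperBound A s × (∀ b → IsUpperBound A b → s ≤ b)

  open IsStrictTotalOrder isStrictTotalOrder public
    using (compare; _<?_) renaming (_≟_ to _≟ℝ_)

  _≤?_ : Decidable _≤_
  _≤?_ = StrictToNonStrict.decidable′ _≡_ _<_ compare

  _-_ : ℝ → ℝ → ℝ
  x - y = x + (- y)

  fromℕ : ℕ → ℝ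
  fromℕ zero    = 0#
  fromℕ (suc k) = 1# + fromℕ k

  tenths : ℕ → ℝ
  tenths k = fromℕ k * fromℕ 10 ⁻¹

  _∈[_,_] : ℝ → ℝ → ℝ → Set
  x ∈[ a , b ] = a ≤ x × x ≤ b

record Names : Set₁ where
  field
    𝒳 𝒞 𝒜 𝒮 : Set
    _≟𝒳_ : DecidableEquality 𝒳
    _≟𝒞_ : DecidableEquality 𝒞
    _≟𝒜_ : DecidableEquality 𝒜
    _≟𝒮_ : DecidableEquality 𝒮

-- Constructors of the sum type Value below.  An output without a value, used
-- for pure synchronisation, transmits the dummy value noValue.
pattern noValue  = inj₁ tt
pattern bool b   = inj₂ (inj₁ b)
pattern int i    = inj₂ (inj₂ (inj₁ i))
pattern real r   = inj₂ (inj₂ (inj₂ (inj₁ r)))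
pattern name m   = inj₂ (inj₂ (inj₂ (inj₂ m)))

module Calculus (𝓡 : CompleteOrderedField) (𝓝 : Names) where
  open CompleteOrderedField 𝓡
  open Names 𝓝

  Value : Set
  Value = ⊤ ⊎ Bool ⊎ ℤ ⊎ ℝ ⊎ (𝒳 ⊎ 𝒞 ⊎ 𝒜 ⊎ 𝒮)

  _≟ⱽ_ : DecidableEquality Value
  _≟ⱽ_ = Sum.≡-dec Unit._≟_ (Sum.≡-dec Bool._≟_ (Sum.≡-dec ℤ._≟_ (Sum.≡-dec _≟ℝ_
           (Sum.≡-dec _≟𝒳_ (Sum.≡-dec _≟𝒞_ (Sum.≡-dec _≟𝒜_ _≟𝒮_))))))

  ℝ^ : {N : Set} → Pred N 0ℓ → Set
  ℝ^ N̂ = ∀ n → n ∈ N̂ → ℝ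

  record Env (X̂ : Pred 𝒳 0ℓ) (Â : Pred 𝒜 0ℓ) (Ŝ : Pred 𝒮 0ℓ) : Set₁ where
    field
      ξx   : ℝ^ X̂
      ξu   : ℝ^ Â
      ξw   : ℝ^ X̂
      evol : ℝ^ X̂ → ℝ^ Â → ℝ^ X̂ → Pred (ℝ^ X̂) 0ℓ
      ξe   : ℝ^ Ŝ
      meas : ℝ^ X̂ → ℝ^ Ŝ → Pred (ℝ^ Ŝ) 0ℓ
      inv  : ℝ^ X̂ → Bool

  module _ {X̂ : Pred 𝒳 0ℓ} {Â : Pred 𝒜 0ℓ} {Ŝ : Pred 𝒮 0ℓ} where
    open Env

    read-sensor : Env X̂ Â Ŝ → 𝒮 → Pred ℝ 0ℓ
    read-sensor E s v =
      ∃ λ ξ → ξ ∈ meas E (ξx E) (ξe E) × ∃ λ (s∈Ŝ : s ∈ Ŝ) → ξ s s∈Ŝ ≡ v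

    update-act : Env X̂ Â Ŝ → 𝒜 → ℝ → Env X̂ Â Ŝ
    update-act E a v = record E
      { ξu = λ b b∈Â → ifᵇ does (b ≟𝒜 a) then v else ξu E b b∈Â }

    next : Env X̂ Â Ŝ → Pred (Env X̂ Â Ŝ) (lsuc 0ℓ)
    next E E′ = ∃ λ ξ → ξ ∈ evol E (ξx E) (ξu E) (ξw E) × E′ ≡ record E { ξx = ξ }

    invariant : Env X̂ Â Ŝ → Bool
    invariant E = inv E (ξx E)

  data Term (m : ℕ) : Set where
    val : Value → Term m
    var : Fin m → Term m

  ⟦_⟧ : ∀ {m} → Term m → (Fin m → Value) → Value
  ⟦ val v ⟧ ρ = v
  ⟦ var x ⟧ ρ = ρ x

  -- A guard is a decidable predicate of the values of its free variables.
  Guard : ℕ → Set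
  Guard m = (Fin m → Value) → Bool

  infixr 6 tick∙_
  infixl 5 _∥_ _∖_

  mutual
    -- Processes with m free value variables and n free process variables
    -- (de Bruijn indices); closed ones are Proc 0 0.
    data Proc (m n : ℕ) : Set where
      nil     : Proc m n
      tick∙_  : Proc m n → Proc m n
      _∥_     : Proc m n → Proc m n → Proc m n
      ⌊_⌋_    : Prefixed m n → Proc m n → Proc m n
      if_then_else_ : Guard m → Proc m n → Proc m n → Proc m n
      _∖_     : Proc m n → 𝒞 → Proc m n
      pvar    : Fin n → Proc m n
      fix     : Proc m (suc n) → Proc m n

    -- A prefix together with its continuation, i.e. π.P
    data Prefixed (m n : ℕ) : Set where
      send  : 𝒞 → Term m → Proc m n → Prefixed m n
      recv  : 𝒞 → Proc (suc m) n → Prefixed m n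
      read  : 𝒮 → Proc (suc m) n → Prefixed m n
      write : 𝒜 → Term m → Proc m n → Prefixed m n

  Process : Set
  Process = Proc 0 0

  renᵀ : ∀ {m m′} → (Fin m → Fin m′) → Term m → Term m′
  renᵀ ρ (val v) = val v
  renᵀ ρ (var x) = var (ρ x)

  mutual
    ren : ∀ {m m′ n n′} → (Fin m → Fin m′) → (Fin n → Fin n′) → Proc m n → Proc m′ n′
    ren ρ κ nil               = nil
    ren ρ κ (tick∙ P)         = tick∙ ren ρ κ P
    ren ρ κ (P ∥ Q)           = ren ρ κ P ∥ ren ρ κ Q
    ren ρ κ (⌊ πP ⌋ Q)        = ⌊ renᴾ ρ κ πP ⌋ ren ρ κ Q
    ren ρ κ (if b then P else Q) = if (λ η → b (η ∘ ρ)) then ren ρ κ P else ren ρ κ Q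
    ren ρ κ (P ∖ c)           = ren ρ κ P ∖ c
    ren ρ κ (pvar X)          = pvar (κ X)
    ren ρ κ (fix P)           = fix (ren ρ (lift 1 κ) P)

    renᴾ : ∀ {m m′ n n′} → (Fin m → Fin m′) → (Fin n → Fin n′) →
           Prefixed m n → Prefixed m′ n′
    renᴾ ρ κ (send c t P)  = send c (renᵀ ρ t) (ren ρ κ P)
    renᴾ ρ κ (recv c P)    = recv c (ren (lift 1 ρ) κ P)
    renᴾ ρ κ (read s P)    = read s (ren (lift 1 ρ) κ P)
    renᴾ ρ κ (write a t P) = write a (renᵀ ρ t) (ren ρ κ P)

  subᵀ : ∀ {m m′} → (Fin m → Term m′) → Term m → Term m′
  subᵀ σ (val v) = val v
  subᵀ σ (var x) = σ x

  mutual
    sub : ∀ {m m′ n n′} → (Fin m → Term m′) → (Fin n → Proc m′ n′) → Proc m n → Proc m′ n′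
    sub σ θ nil               = nil
    sub σ θ (tick∙ P)         = tick∙ sub σ θ P
    sub σ θ (P ∥ Q)           = sub σ θ P ∥ sub σ θ Q
    sub σ θ (⌊ πP ⌋ Q)        = ⌊ subᴾ σ θ πP ⌋ sub σ θ Q
    sub σ θ (if b then P else Q) =
      if (λ η → b (λ x → ⟦ σ x ⟧ η)) then sub σ θ P else sub σ θ Q
    sub σ θ (P ∖ c)           = sub σ θ P ∖ c
    sub σ θ (pvar X)          = θ X
    sub σ θ (fix P)           = fix (sub σ (pvar zero ∷ (ren id suc ∘ θ)) P)

    subᴾ : ∀ {m m′ n n′} → (Fin m → Term m′) → (Fin n → Proc m′ n′) →
           Prefixed m n → Prefixed m′ n′
    subᴾ σ θ (send c t P)  = send c (subᵀ σ t) (sub σ θ P)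
    subᴾ σ θ (recv c P)    = recv c (sub (var zero ∷ (renᵀ suc ∘ σ)) (ren suc id ∘ θ) P)
    subᴾ σ θ (read s P)    = read s (sub (var zero ∷ (renᵀ suc ∘ σ)) (ren suc id ∘ θ) P)
    subᴾ σ θ (write a t P) = write a (subᵀ σ t) (sub σ θ P)

  _[_/x] : ∀ {m n} → Proc (suc m) n → Value → Proc m n
  P [ v /x] = sub (val v ∷ var) pvar P

  _[_/X] : ∀ {m n} → Proc m (suc n) → Proc m n → Proc m n
  P [ Q /X] = sub var (Q ∷ pvar) P

  -- The abbreviation π.P = fix X.⌊π.P⌋X, with X not free in P
  prefix : ∀ {m n} → Prefixed m n → Proc m n
  prefix πP = fix (⌊ renᴾ id suc πP ⌋ pvar zero)

  tick^ : ∀ {m n} → ℕ → Proc m n → Proc m n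
  tick^ zero    P = P
  tick^ (suc k) P = tick∙ tick^ k P

  -- The rule for P ∥ Q —tick→ has a negative premise on
  -- τ-transitions, so the transitions other than tick are defined first; none
  -- of their rules has a tick-transition as a premise.  The identification of
  -- if with its chosen branch is expressed by the rules ifT and ifF.

  data Label : Set where
    τ       : Label
    out inp : 𝒞 → Value → Label
    act     : 𝒜 → Value → Label
    sens    : 𝒮 → Value → Label

  channel : Label → Maybe 𝒞
  channel (out c _) = just c
  channel (inp c _) = just c
  channel _         = nothing

  infix 3 _—[_]→_ _—tick→_

  closed : Fin 0 → Value
  closed ()

  data _—[_]→_ : Process → Label → Process → Set where
    outp   : ∀ {c t P Q} → ⌊ send c t P ⌋ Q —[ out c (⟦ t ⟧ closed) ]→ P
    inpp   : ∀ {c v P Q} → ⌊ recv c P ⌋ Q —[ inp c v ]→ P [ v /x]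
    writep : ∀ {a t P Q} → ⌊ write a t P ⌋ Q —[ act a (⟦ t ⟧ closed) ]→ P
    readp  : ∀ {s v P Q} → ⌊ read s P ⌋ Q —[ sens s v ]→ P [ v /x]
    comˡ   : ∀ {c v P P′ Q Q′} →
             P —[ out c v ]→ P′ → Q —[ inp c v ]→ Q′ → P ∥ Q —[ τ ]→ P′ ∥ Q′
    comʳ   : ∀ {c v P P′ Q Q′} →
             P —[ inp c v ]→ P′ → Q —[ out c v ]→ Q′ → P ∥ Q —[ τ ]→ P′ ∥ Q′
    parˡ   : ∀ {l P P′ Q} → P —[ l ]→ P′ → P ∥ Q —[ l ]→ P′ ∥ Q
    parʳ   : ∀ {l P Q Q′} → Q —[ l ]→ Q′ → P ∥ Q —[ l ]→ P ∥ Q′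
    res    : ∀ {l c P P′} → P —[ l ]→ P′ → channel l ≢ just c → P ∖ c —[ l ]→ P′ ∖ c
    rec    : ∀ {l P Q} → P [ fix P /X] —[ l ]→ Q → fix P —[ l ]→ Q
    ifT    : ∀ {l b P P′ Q} → b closed ≡ true  → P —[ l ]→ P′ → if b then P else Q —[ l ]→ P′
    ifF    : ∀ {l b P Q Q′} → b closed ≡ false → Q —[ l ]→ Q′ → if b then P else Q —[ l ]→ Q′

  data _—tick→_ : Process → Process → Set where
    nil     : nil —tick→ nil
    delay   : ∀ {P} → tick∙ P —tick→ P
    timeout : ∀ {πP Q} → ⌊ πP ⌋ Q —tick→ Q
    par     : ∀ {P P′ Q Q′} → P —tick→ P′ → Q —tick→ Q′ →
              (∀ R → ¬ (P ∥ Q —[ τ ]→ R)) → P ∥ Q —tick→ P′ ∥ Q′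
    res     : ∀ {c P P′} → P —tick→ P′ → P ∖ c —tick→ P′ ∖ c
    rec     : ∀ {P Q} → P [ fix P /X] —tick→ Q → fix P —tick→ Q
    ifT     : ∀ {b P P′ Q} → b closed ≡ true  → P —tick→ P′ → if b then P else Q —tick→ P′
    ifF     : ∀ {b P Q Q′} → b closed ≡ false → Q —tick→ Q′ → if b then P else Q —tick→ Q′

  infix 4 _⋈_

  record CPS : Set₁ where
    constructor _⋈_
    field
      {X̂}  : Pred 𝒳 0ℓ
      {Â}  : Pred 𝒜 0ℓ
      {Ŝ}  : Pred 𝒮 0ℓ
      env  : Env X̂ Â Ŝ
      proc : Process

  -- All occurrences of the given process variable are time-guarded.
  mutual
    timeGuarded : ∀ {m n} → Fin n → Proc m n → Bool
    timeGuarded X nil                = true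
    timeGuarded X (tick∙ P)          = true
    timeGuarded X (P ∥ Q)            = timeGuarded X P ∧ timeGuarded X Q
    timeGuarded X (⌊ πP ⌋ Q)         = timeGuardedᴾ X πP
    timeGuarded X (if b then P else Q) = timeGuarded X P ∧ timeGuarded X Q
    timeGuarded X (P ∖ c)            = timeGuarded X P
    timeGuarded X (pvar Y)           = not (does (X Fin.≟ Y))
    timeGuarded X (fix P)            = timeGuarded (suc X) P

    timeGuardedᴾ : ∀ {m n} → Fin n → Prefixed m n → Bool
    timeGuardedᴾ X (send c t P)  = timeGuarded X P
    timeGuardedᴾ X (recv c P)    = timeGuarded X P
    timeGuardedᴾ X (read s P)    = timeGuarded X P
    timeGuardedᴾ X (write a t P) = timeGuarded X P

  -- Recursion is time-guarded, and the actuators and sensors mentioned are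
  -- in Â and Ŝ.
  module _ (Â : Pred 𝒜 0ℓ) (Ŝ : Pred 𝒮 0ℓ) where
    mutual
      WellFormedProc : ∀ {m n} → Proc m n → Set
      WellFormedProc nil                = ⊤
      WellFormedProc (tick∙ P)          = WellFormedProc P
      WellFormedProc (P ∥ Q)            = WellFormedProc P × WellFormedProc Q
      WellFormedProc (⌊ πP ⌋ Q)         = WellFormedPrefixed πP × WellFormedProc Q
      WellFormedProc (if b then P else Q) = WellFormedProc P × WellFormedProc Q
      WellFormedProc (P ∖ c)            = WellFormedProc P
      WellFormedProc (pvar X)           = ⊤
      WellFormedProc (fix P)            = T (timeGuarded zero P) × WellFormedProc P

      WellFormedPrefixed : ∀ {m n} → Prefixed m n → Set
      WellFormedPrefixed (send c t P)  = WellFormedProc P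
      WellFormedPrefixed (recv c P)    = WellFormedProc P
      WellFormedPrefixed (read s P)    = s ∈ Ŝ × WellFormedProc P
      WellFormedPrefixed (write a t P) = a ∈ Â × WellFormedProc P

  WellFormed : CPS → Set
  WellFormed M = WellFormedProc (CPS.Â M) (CPS.Ŝ M) (CPS.proc M)

  -- As for processes, tick has a rule with a negative premise and is added last.
  data Instantaneous : Set where
    τ       : Instantaneous
    out inp : 𝒞 → Value → Instantaneous

  data Action : Set where
    instantaneous : Instantaneous → Action
    tick          : Action

  infix 3 _—⟨_⟩→₀_ _—⟨_⟩→_ _⇒_ _⇒⟨_⟩_ _⇛⟨_⟩_ _≈_

  Invariant : ∀ {X̂ Â Ŝ} → Env X̂ Â Ŝ → Set
  Invariant E = invariant E ≡ true

  data _—⟨_⟩→₀_ : CPS → Instantaneous → CPS → Set₁ where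
    Out : ∀ {X̂ Â Ŝ} {E : Env X̂ Â Ŝ} {P P′ c v} → Invariant E →
          P —[ out c v ]→ P′ → (E ⋈ P) —⟨ out c v ⟩→₀ (E ⋈ P′)
    Inp : ∀ {X̂ Â Ŝ} {E : Env X̂ Â Ŝ} {P P′ c v} → Invariant E →
          P —[ inp c v ]→ P′ → (E ⋈ P) —⟨ inp c v ⟩→₀ (E ⋈ P′)
    SensRead : ∀ {X̂ Â Ŝ} {E : Env X̂ Â Ŝ} {P P′ s r} → Invariant E →
               P —[ sens s (real r) ]→ P′ → r ∈ read-sensor E s →
               (E ⋈ P) —⟨ τ ⟩→₀ (E ⋈ P′)
    ActWrite : ∀ {X̂ Â Ŝ} {E : Env X̂ Â Ŝ} {P P′ a r} → Invariant E →
               P —[ act a (real r) ]→ P′ →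
               (E ⋈ P) —⟨ τ ⟩→₀ (update-act E a r ⋈ P′)
    Tau : ∀ {X̂ Â Ŝ} {E : Env X̂ Â Ŝ} {P P′} → Invariant E →
          P —[ τ ]→ P′ → (E ⋈ P) —⟨ τ ⟩→₀ (E ⋈ P′)

  data _—⟨_⟩→_ : CPS → Action → CPS → Set₁ where
    inst : ∀ {M M′ α} → M —⟨ α ⟩→₀ M′ → M —⟨ instantaneous α ⟩→ M′
    Time : ∀ {X̂ Â Ŝ} {E E′ : Env X̂ Â Ŝ} {P P′} → Invariant E →
           P —tick→ P′ → (∀ M → ¬ ((E ⋈ P) —⟨ τ ⟩→₀ M)) → E′ ∈ next E →
           (E ⋈ P) —⟨ tick ⟩→ (E′ ⋈ P′)

  infixl 5 _∥ᶜ_ _∖ᶜ_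

  _∥ᶜ_ : CPS → Process → CPS
  (E ⋈ P) ∥ᶜ Q = E ⋈ (P ∥ Q)

  _∖ᶜ_ : CPS → 𝒞 → CPS
  (E ⋈ P) ∖ᶜ c = E ⋈ (P ∖ c)

  _⇒_ : CPS → CPS → Set₁
  _⇒_ = Star (λ M M′ → M —⟨ instantaneous τ ⟩→ M′)

  _⇒⟨_⟩_ : CPS → Action → CPS → Set₁
  M ⇒⟨ α ⟩ M′ = ∃₂ λ N N′ → M ⇒ N × N —⟨ α ⟩→ N′ × N′ ⇒ M′

  _⇛⟨_⟩_ : CPS → Action → CPS → Set₁
  M ⇛⟨ instantaneous τ ⟩ M′ = M ⇒ M′
  M ⇛⟨ α ⟩ M′               = M ⇒⟨ α ⟩ M′

  record IsBisimulation (R : Rel CPS (lsuc 0ℓ)) : Set₁ where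
    field
      symmetric : Symmetric R
      simulates : ∀ {M N M′ α} → R M N → M —⟨ α ⟩→ M′ →
                  ∃ λ N′ → N ⇛⟨ α ⟩ N′ × R M′ N′

  _≈_ : CPS → CPS → Set₂
  M ≈ N = ∃ λ R → IsBisimulation R × R M N

  module _ {N : Set} {N̂₁ N̂₂ : Pred N 0ℓ} where
    _⊎ᶠ_ : ℝ^ N̂₁ → ℝ^ N̂₂ → ℝ^ (N̂₁ ∪ N̂₂)
    (ξ₁ ⊎ᶠ ξ₂) n = [ ξ₁ n , ξ₂ n ]

    _⊎ˢ_ : Pred (ℝ^ N̂₁) 0ℓ → Pred (ℝ^ N̂₂) 0ℓ → Pred (ℝ^ (N̂₁ ∪ N̂₂)) 0ℓ
    (Ξ₁ ⊎ˢ Ξ₂) ξ = ∃₂ λ ξ₁ ξ₂ → ξ₁ ∈ Ξ₁ × ξ₂ ∈ Ξ₂ × ξ ≡ ξ₁ ⊎ᶠ ξ₂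

  module _ {N : Set} (N̂₁ N̂₂ : Pred N 0ℓ) where
    restrict₁ : ℝ^ (N̂₁ ∪ N̂₂) → ℝ^ N̂₁
    restrict₁ ξ n n∈N̂₁ = ξ n (inj₁ n∈N̂₁)

    restrict₂ : ℝ^ (N̂₁ ∪ N̂₂) → ℝ^ N̂₂
    restrict₂ ξ n n∈N̂₂ = ξ n (inj₂ n∈N̂₂)

  module _ {X̂₁ X̂₂ : Pred 𝒳 0ℓ} {Â₁ Â₂ : Pred 𝒜 0ℓ} {Ŝ₁ Ŝ₂ : Pred 𝒮 0ℓ} where
    unionᴱ : Env X̂₁ Â₁ Ŝ₁ → Env X̂₂ Â₂ Ŝ₂ → X̂₁ ⊥ X̂₂ → Â₁ ⊥ Â₂ → Ŝ₁ ⊥ Ŝ₂ →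
             Env (X̂₁ ∪ X̂₂) (Â₁ ∪ Â₂) (Ŝ₁ ∪ Ŝ₂)
    unionᴱ E₁ E₂ _ _ _ = record
      { ξx   = E₁.ξx ⊎ᶠ E₂.ξx
      ; ξu   = E₁.ξu ⊎ᶠ E₂.ξu
      ; ξw   = E₁.ξw ⊎ᶠ E₂.ξw
      ; evol = λ ξ ψ φ →
          E₁.evol (restrict₁ X̂₁ X̂₂ ξ) (restrict₁ Â₁ Â₂ ψ) (restrict₁ X̂₁ X̂₂ φ) ⊎ˢ
          E₂.evol (restrict₂ X̂₁ X̂₂ ξ) (restrict₂ Â₁ Â₂ ψ) (restrict₂ X̂₁ X̂₂ φ)
      ; ξe   = E₁.ξe ⊎ᶠ E₂.ξe
      ; meas = λ ξ ψ →
          E₁.meas (restrict₁ X̂₁ X̂₂ ξ) (restrict₁ Ŝ₁ Ŝ₂ ψ) ⊎ˢ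
          E₂.meas (restrict₂ X̂₁ X̂₂ ξ) (restrict₂ Ŝ₁ Ŝ₂ ψ)
      ; inv  = λ ξ → E₁.inv (restrict₁ X̂₁ X̂₂ ξ) ∧ E₂.inv (restrict₂ X̂₁ X̂₂ ξ)
      }
      where
      module E₁ = Env E₁
      module E₂ = Env E₂

  record Disjoint (M₁ M₂ : CPS) : Set where
    private
      module M₁ = CPS M₁
      module M₂ = CPS M₂
    field
      X̂-disjoint : M₁.X̂ ⊥ M₂.X̂
      Â-disjoint : M₁.Â ⊥ M₂.Â
      Ŝ-disjoint : M₁.Ŝ ⊥ M₂.Ŝ

  union : (M₁ M₂ : CPS) → Disjoint M₁ M₂ → CPS
  union (E₁ ⋈ P₁) (E₂ ⋈ P₂) d =
    unionᴱ E₁ E₂ d.X̂-disjoint d.Â-disjoint d.Ŝ-disjoint ⋈ (P₁ ∥ P₂)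
    where module d = Disjoint d

-- Names, identifiers and actuator commands of the case study.  A real value
-- ≥ 0 of an actuator stands for "off" and a value < 0 for "on", so on and off
-- may be any reals of the respective sign.
record Vocabulary (𝓡 : CompleteOrderedField) (𝓝 : Names) : Set where
  open CompleteOrderedField 𝓡
  open Names 𝓝
  open Calculus 𝓡 𝓝 using (Value)
  field
    temp-l temp-r           : 𝒳
    cool-l cool-r           : 𝒜
    st-l st-r               : 𝒮
    warning alarm failure   : 𝒞
    L R                     : Value
    on off                  : ℝ

    temp-l≢temp-r   : temp-l ≢ temp-r
    cool-l≢cool-r   : cool-l ≢ cool-r
    st-l≢st-r       : st-l ≢ st-r
    warning≢alarm   : warning ≢ alarm
    warning≢failure : warning ≢ failure
    alarm≢failure   : alarm ≢ failure
    L≢R             : L ≢ R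
    on<0            : on < 0#
    0≤off           : 0# ≤ off

module CaseStudy (𝓡 : CompleteOrderedField) (𝓝 : Names) (𝓥 : Vocabulary 𝓡 𝓝) where
  open CompleteOrderedField 𝓡
  open Names 𝓝
  open Calculus 𝓡 𝓝
  open Vocabulary 𝓥

  δ ε : ℝ
  δ = tenths 4
  ε = tenths 1

  -- coolRate is minus the value of heat when the cooling is on.
  heat : (coolRate : ℝ) (cool : 𝒜) → ℝ^ ｛ cool ｝ → ℝ
  heat coolRate cool ξu = ifᵇ does (ξu cool refl <? 0#) then - coolRate else 1#

  engineEnv : (coolRate : ℝ) (temp : 𝒳) (cool : 𝒜) (st : 𝒮) →
              Env ｛ temp ｝ ｛ cool ｝ ｛ st ｝
  engineEnv coolRate temp cool st = record
    { ξx   = λ _ _ → 0#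
    ; ξu   = λ _ _ → off
    ; ξw   = λ _ _ → δ
    ; evol = λ ξx ξu ξw ξ → ∃ λ γ → γ ∈[ - δ , δ ] ×
               ξ temp refl ≡ ξx temp refl + heat coolRate cool ξu + γ
    ; ξe   = λ _ _ → ε
    ; meas = λ ξx ξe ξ → ξ st refl ∈[ ξx temp refl - ε , ξx temp refl + ε ]
    ; inv  = λ ξx → does (0# ≤? ξx temp refl) ∧ does (ξx temp refl ≤? fromℕ 30)
    }

  exceeds10 : Value → Bool
  exceeds10 (real r) = does (fromℕ 10 <? r)
  exceeds10 _        = false

  is : Value → Value → Bool
  is id v = does (v ≟ⱽ id)

  -- The process variable X of Ctrl is a parameter.
  Cooling : ∀ {m n} → Value → 𝒜 → 𝒮 → (X : Fin n) → Proc m n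
  Cooling ID cool st X =
    prefix (write cool (val (real on)) (
      fix (tick^ 5 (prefix (read st (
        if (λ η → exceeds10 (η zero))
        then prefix (send warning (val ID) (pvar zero))
        else prefix (write cool (val (real off)) (tick∙ pvar (suc X)))))))))

  Ctrl : Value → 𝒜 → 𝒮 → Process
  Ctrl ID cool st =
    fix (prefix (read st (
      if (λ η → exceeds10 (η zero))
      then Cooling ID cool st zero
      else (tick∙ pvar zero))))

  engine : (coolRate : ℝ) → Value → 𝒳 → 𝒜 → 𝒮 → CPS
  engine coolRate ID temp cool st = engineEnv coolRate temp cool st ⋈ Ctrl ID cool st

  Eng EngBar : Value → 𝒳 → 𝒜 → 𝒮 → CPS
  Eng    = engine 1#
  EngBar = engine (tenths 8)

  EngL EngR EngBarL EngBarR : CPS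
  EngL    = Eng L temp-l cool-l st-l
  EngR    = Eng R temp-r cool-r st-r
  EngBarL = EngBar L temp-l cool-l st-l
  EngBarR = EngBar R temp-r cool-r st-r

  -- The process variable X of Check is a parameter.
  Check₅ : ∀ {m n} → Value → (X : Fin n) → Proc m n
  Check₅ id X =
    ⌊ recv warning (
        if (λ η → not (is id (η zero)))
        then prefix (send alarm (val noValue) (tick∙ pvar X))
        else prefix (send failure (val id) (tick∙ pvar X)))
    ⌋ prefix (send failure (val id) (pvar X))

  -- Check⟨5- k ⟩ is Check₅₋ₖ.
  Check⟨5-_⟩ : ∀ {m n} → ℕ → Value → (X : Fin n) → Proc m n
  Check⟨5- zero  ⟩ id X = Check₅ id X
  Check⟨5- suc k ⟩ id X =
    ⌊ recv warning (
        if (λ η → not (is id (η zero)))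
        then prefix (send alarm (val noValue) (tick∙ pvar X))
        else (tick∙ Check⟨5- k ⟩ id X))
    ⌋ Check⟨5- k ⟩ id X

  Check₁ : ∀ {m n} → Value → (X : Fin n) → Proc m n
  Check₁ = Check⟨5- 4 ⟩

  Check : Process
  Check =
    fix (⌊ recv warning (
             if (λ η → is L (η zero)) then Check₁ L zero else Check₁ R zero)
         ⌋ pvar zero)

  engines-disjoint : ∀ {κ₁ κ₂} →
    Disjoint (engine κ₁ L temp-l cool-l st-l) (engine κ₂ R temp-r cool-r st-r)
  engines-disjoint = record
    { X̂-disjoint = λ { (p , q) → temp-l≢temp-r (trans p (sym q)) }
    ; Â-disjoint = λ { (p , q) → cool-l≢cool-r (trans p (sym q)) }
    ; Ŝ-disjoint = λ { (p , q) → st-l≢st-r (trans p (sym q)) }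
    }

  Airplane AirplaneBar : CPS
  Airplane    = (union EngL EngR engines-disjoint ∥ᶜ Check) ∖ᶜ warning
  AirplaneBar = (union EngBarL EngBarR engines-disjoint ∥ᶜ Check) ∖ᶜ warning

  Ctrl-wellFormed : ∀ Â Ŝ {ID cool st} → cool ∈ Â → st ∈ Ŝ →
                    WellFormedProc Â Ŝ (Ctrl ID cool st)
  Ctrl-wellFormed Â Ŝ cool∈Â st∈Ŝ =
    _ , _ , (st∈Ŝ , (_ , (cool∈Â ,
      _ , _ , (st∈Ŝ , _ , (_ , (cool∈Â , _) , _)) , _) , _) , _) , _

  Airplane-wellFormed : WellFormed Airplane
  Airplane-wellFormed =
    (Ctrl-wellFormed Â Ŝ {L} (inj₁ refl) (inj₁ refl) ,
     Ctrl-wellFormed Â Ŝ {R} (inj₂ refl) (inj₂ refl)) , _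
    where open CPS Airplane

  AirplaneBar-wellFormed : WellFormed AirplaneBar
  AirplaneBar-wellFormed = Airplane-wellFormed

{-# OPTIONS --safe #-}

-- No engine, whatever its cooling rate κ ∈ [0.8, 1], ever sends a warning.
-- Cooling starts from a temperature in [9.9, 11.5]: the reading exceeds 10, while
-- one step earlier the reading was at most 10, the temperature at most 10.1, and a
-- heating step adds at most 1.4.  A cooling step subtracts between 0.4 and 1.4, so
-- after five of them the temperature is in [2.9, 9.5] and the reading is below 10.
-- Temperatures thus stay in [0, 11.5], well within the invariant, and both
-- airplanes only do τ's and tick's: a step τ is matched by doing nothing, and a
-- tick by finitely many τ's leading to a tick, which are always available.
-- Hence relating all reachable airplanes with each other gives a bisimulation.
module Submission where

open import Defs
open import Algebra.Bundles using (CommutativeRing)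
import Algebra.Properties.AbelianGroup as AbelianGroupProperties
import Algebra.Properties.Ring as RingProperties
open import Data.Bool.Base using (true; false; _∧_) renaming (if_then_else_ to ifᵇ_then_else_)
open import Data.Empty using (⊥-elim)
open import Data.Fin.Base using (zero; suc)
open import Data.Nat.Base as ℕ using (zero; suc)
import Data.Nat.Properties as ℕ
open import Data.Product.Base using (∃; ∃₂; _×_; _,_; proj₁; proj₂)
open import Data.Sum.Base using (inj₁; inj₂; [_,_])
open import Data.Vec.Functional using (_∷_)
open import Function.Base using (id; _∘_)
open import Level using (0ℓ)
open import Relation.Binary.Bundles using (StrictTotalOrder; DecTotalOrder)
open import Relation.Binary.Construct.Closure.ReflexiveTransitive using (_◅_) renaming (ε to ε*)
open import Relation.Binary.Definitions using (tri<; tri≈; tri>)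
import Relation.Binary.Properties.StrictTotalOrder as StrictTotalOrderProperties
open import Relation.Binary.PropositionalEquality
  using (_≡_; _≢_; refl; sym; trans; cong; cong₂; subst; subst₂)
import Relation.Binary.Reasoning.PartialOrder as PartialOrderReasoning
open import Relation.Nullary using (¬_; does)
open import Relation.Nullary.Decidable using (yes; no; dec-true; dec-false)
open import Relation.Unary using (Pred; _∈_; _∪_; ｛_｝)

-- Ordered-field arithmetic, up to the temperature change per tick.

module OrderedField (𝓡 : CompleteOrderedField) where
  open CompleteOrderedField 𝓡

  commutativeRing : CommutativeRing _ _
  commutativeRing = record { isCommutativeRing = isCommutativeRing }

  strictTotalOrder : StrictTotalOrder _ _ _
  strictTotalOrder = record { isStrictTotalOrder = isStrictTotalOrder }

  open CommutativeRing commutativeRing public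
    using (+-assoc; +-comm; +-identityˡ; +-identityʳ; -‿inverseʳ; distribʳ; zeroˡ; zeroʳ)
  open AbelianGroupProperties (CommutativeRing.+-abelianGroup commutativeRing)
    using (xyx⁻¹≈y; //-rightDividesˡ; //-rightDividesʳ)
  open RingProperties (CommutativeRing.ring commutativeRing) using (-‿distribʳ-*)
  open StrictTotalOrder strictTotalOrder using (irrefl) renaming (trans to <-trans)
  open DecTotalOrder (StrictTotalOrderProperties.decTotalOrder strictTotalOrder) public
    using (poset) renaming (refl to ≤-refl; trans to ≤-trans)
  module ≤-Reasoning = PartialOrderReasoning poset

  <⇒≤ : ∀ {x y} → x < y → x ≤ y
  <⇒≤ = inj₁

  ≤⇒≯ : ∀ {x y} → x ≤ y → ¬ y < x
  ≤⇒≯ (inj₁ x<y)  y<x = irrefl refl (<-trans x<y y<x)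
  ≤⇒≯ (inj₂ refl) y<x = irrefl refl y<x

  ≮⇒≥ : ∀ {x y} → ¬ x < y → y ≤ x
  ≮⇒≥ {x} {y} x≮y with compare x y
  ... | tri< x<y _ _ = ⊥-elim (x≮y x<y)
  ... | tri≈ _ x≡y _ = inj₂ (sym x≡y)
  ... | tri> _ _ y<x = inj₁ y<x

  +-monoˡ-≤ : ∀ z {x y} → x ≤ y → x + z ≤ y + z
  +-monoˡ-≤ z (inj₁ x<y) = inj₁ (+-monoˡ-< z x<y)
  +-monoˡ-≤ z (inj₂ x≡y) = inj₂ (cong (_+ z) x≡y)

  +-mono-≤ : ∀ {w x y z} → w ≤ x → y ≤ z → w + y ≤ x + z
  +-mono-≤ {w} {x} {y} {z} w≤x y≤z =
    ≤-trans (+-monoˡ-≤ y w≤x)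
            (subst₂ _≤_ (+-comm y x) (+-comm z x) (+-monoˡ-≤ x y≤z))

  neg-anti-≤ : ∀ {x y} → x ≤ y → - y ≤ - x
  neg-anti-≤ {x} {y} x≤y = begin
    - y                ≡⟨ xyx⁻¹≈y x (- y) ⟨
    x + - y + - x      ≤⟨ +-monoˡ-≤ (- x) (+-monoˡ-≤ (- y) x≤y) ⟩
    y + - y + - x      ≡⟨ cong (_+ - x) (-‿inverseʳ y) ⟩
    0# + - x           ≡⟨ +-identityˡ (- x) ⟩
    - x                ∎
    where open ≤-Reasoning

  0<fromℕ-suc : ∀ n → 0# < fromℕ (suc n)
  0<fromℕ-suc zero    = subst (0# <_) (sym (+-identityʳ 1#)) 0<1
  0<fromℕ-suc (suc n) =
    <-trans 0<1 (subst₂ _<_ (+-identityˡ 1#) (+-comm _ 1#) (+-monoˡ-< 1# (0<fromℕ-suc n)))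

  -- A zero inverse gives `0# ≡ 1#`; for a negative one, `x * - (x ⁻¹)`, which equals -1, would be a
  -- product of positives.
  x⁻¹-pos : ∀ {x} → 0# < x → 0# < x ⁻¹
  x⁻¹-pos {x} 0<x with compare 0# (x ⁻¹)
  ... | tri< 0<x⁻¹ _ _ = 0<x⁻¹
  ... | tri≈ _ 0≡x⁻¹ _ = ⊥-elim (irrefl 0≡1 0<1)
    where
    0≡1 : 0# ≡ 1#
    0≡1 = trans (sym (zeroʳ x))
                (trans (cong (x *_) 0≡x⁻¹) (⁻¹-inverse x (λ { refl → irrefl refl 0<x })))
  ... | tri> _ _ x⁻¹<0 = ⊥-elim (≤⇒≯ (<⇒≤ 0<1) 1<0)
    where
    0<-x⁻¹ : 0# < - (x ⁻¹)
    0<-x⁻¹ = subst₂ _<_ (-‿inverseʳ (x ⁻¹)) (+-identityˡ _) (+-monoˡ-< (- (x ⁻¹)) x⁻¹<0)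
    0<-1 : 0# < - 1#
    0<-1 = subst (0# <_) (trans (sym (-‿distribʳ-* x (x ⁻¹)))
             (cong -_ (⁻¹-inverse x (λ { refl → irrefl refl 0<x })))) (*-pos 0<x 0<-x⁻¹)
    1<0 : 1# < 0#
    1<0 = subst₂ _<_ (+-identityˡ 1#)
            (trans (+-comm (- 1#) 1#) (-‿inverseʳ 1#)) (+-monoˡ-< 1# 0<-1)

  0<10⁻¹ : 0# < fromℕ 10 ⁻¹
  0<10⁻¹ = x⁻¹-pos (0<fromℕ-suc 9)

  -- Decimals as tenths of natural numbers.

  fromℕ-+ : ∀ m n → fromℕ (m ℕ.+ n) ≡ fromℕ m + fromℕ n
  fromℕ-+ zero    n = sym (+-identityˡ _)
  fromℕ-+ (suc m) n = trans (cong (1# +_) (fromℕ-+ m n)) (sym (+-assoc _ _ _))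

  tenths-+ : ∀ m n → tenths (m ℕ.+ n) ≡ tenths m + tenths n
  tenths-+ m n = trans (cong (_* _) (fromℕ-+ m n)) (distribʳ _ _ _)

  0≤tenths : ∀ n → 0# ≤ tenths n
  0≤tenths zero    = inj₂ (sym (zeroˡ _))
  0≤tenths (suc n) = inj₁ (*-pos (0<fromℕ-suc n) 0<10⁻¹)

  -- With every constant written as `tenths` of a numeral, comparing decimals becomes a comparison
  -- in `ℕ`.
  tenths-mono-≤ : ∀ {m n} → m ℕ.≤ n → tenths m ≤ tenths n
  tenths-mono-≤ {m} {n} m≤n = begin
    tenths m                        ≡⟨ +-identityˡ _ ⟨
    0# + tenths m                   ≤⟨ +-monoˡ-≤ _ (0≤tenths (n ℕ.∸ m)) ⟩
    tenths (n ℕ.∸ m) + tenths m     ≡⟨ tenths-+ (n ℕ.∸ m) m ⟨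
    tenths (n ℕ.∸ m ℕ.+ m)          ≡⟨ cong tenths (ℕ.m∸n+n≡m m≤n) ⟩
    tenths n                        ∎
    where open ≤-Reasoning

  tenths-10 : tenths 10 ≡ 1#
  tenths-10 = ⁻¹-inverse _ (λ 10≡0 → irrefl (sym 10≡0) (0<fromℕ-suc 9))

  tenths-10* : ∀ n → tenths (n ℕ.* 10) ≡ fromℕ n
  tenths-10* zero    = zeroˡ _
  tenths-10* (suc n) = trans (tenths-+ 10 (n ℕ.* 10)) (cong₂ _+_ tenths-10 (tenths-10* n))

  tenths-∸ : ∀ m n → tenths (m ℕ.+ n) - tenths m ≡ tenths n
  tenths-∸ m n = trans (cong (_- tenths m) (tenths-+ m n)) (xyx⁻¹≈y _ _)

  -- In tenths, the step adds at least 10 - 4 = 6, so the temperature stays nonnegative, and at most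
  -- 10 + 4 = 14.
  heating-step : ∀ b {x x′ γ} → γ ∈[ - tenths 4 , tenths 4 ] → x′ ≡ x + 1# + γ →
                 x ∈[ 0# , tenths b ] → x′ ∈[ 0# , tenths (b ℕ.+ 14) ]
  heating-step b {x} {_} {γ} (-4≤γ , γ≤4) refl (0≤x , x≤b) = lower , upper
    where
    open ≤-Reasoning
    1≡0+1 : tenths 10 ≡ 0# + 1#
    1≡0+1 = trans tenths-10 (sym (+-identityˡ 1#))
    lower : 0# ≤ x + 1# + γ
    lower = begin
      0#                             ≤⟨ 0≤tenths 6 ⟩
      tenths 6                       ≡⟨ tenths-∸ 4 6 ⟨
      tenths 10 - tenths 4           ≡⟨ cong (_- tenths 4) 1≡0+1 ⟩
      0# + 1# - tenths 4             ≤⟨ +-mono-≤ (+-monoˡ-≤ 1# 0≤x) -4≤γ ⟩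
      x + 1# + γ                     ∎
    upper : x + 1# + γ ≤ tenths (b ℕ.+ 14)
    upper = begin
      x + 1# + γ                         ≤⟨ +-mono-≤ (+-monoˡ-≤ 1# x≤b) γ≤4 ⟩
      tenths b + 1# + tenths 4           ≡⟨ +-assoc _ _ _ ⟩
      tenths b + (1# + tenths 4)         ≡⟨ cong (λ y → tenths b + (y + tenths 4)) tenths-10 ⟨
      tenths b + (tenths 10 + tenths 4)  ≡⟨ cong (tenths b +_) (tenths-+ 10 4) ⟨
      tenths b + tenths 14               ≡⟨ tenths-+ b 14 ⟨
      tenths (b ℕ.+ 14)                  ∎

  -- In tenths, the step removes at most 10 + 4 = 14 and at least 8 - 4 = 4. The numerals stand to
  -- the left of `a` and `b` so that the sums unfold by computation.
  cooling-step : ∀ a b {x x′ γ κ} → κ ∈[ tenths 8 , tenths 10 ] →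
                 γ ∈[ - tenths 4 , tenths 4 ] → x′ ≡ x + - κ + γ →
                 x ∈[ tenths (14 ℕ.+ a) , tenths (4 ℕ.+ b) ] → x′ ∈[ tenths a , tenths b ]
  cooling-step a b {x} {_} {γ} {κ} (8≤κ , κ≤10) (-4≤γ , γ≤4) refl (a≤x , x≤b) = lower , upper
    where
    open ≤-Reasoning
    lower : tenths a ≤ x + - κ + γ
    lower = begin
      tenths a                                    ≡⟨ tenths-∸ 4 a ⟨
      tenths (4 ℕ.+ a) - tenths 4                 ≡⟨ cong (_- tenths 4) (tenths-∸ 10 (4 ℕ.+ a)) ⟨
      tenths (14 ℕ.+ a) - tenths 10 - tenths 4
        ≤⟨ +-mono-≤ (+-mono-≤ a≤x (neg-anti-≤ κ≤10)) -4≤γ ⟩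
      x + - κ + γ                                 ∎
    upper : x + - κ + γ ≤ tenths b
    upper = begin
      x + - κ + γ                              ≤⟨ +-mono-≤ (+-mono-≤ x≤b (neg-anti-≤ 8≤κ)) γ≤4 ⟩
      tenths (4 ℕ.+ b) - tenths 8 + tenths 4   ≡⟨ +-assoc _ _ _ ⟩
      tenths (4 ℕ.+ b) + (- tenths 8 + tenths 4)
        ≡⟨ cong (tenths (4 ℕ.+ b) +_) (+-comm _ _) ⟩
      tenths (4 ℕ.+ b) + (tenths 4 - tenths 8) ≡⟨ +-assoc _ _ _ ⟨
      tenths (4 ℕ.+ b) + tenths 4 - tenths 8   ≡⟨ cong (_- tenths 8) (+-comm _ _) ⟩
      tenths 4 + tenths (4 ℕ.+ b) - tenths 8   ≡⟨ cong (_- tenths 8) (tenths-+ 4 (4 ℕ.+ b)) ⟨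
      tenths (8 ℕ.+ b) - tenths 8              ≡⟨ tenths-∸ 8 b ⟩
      tenths b                                 ∎

  ≤-reading : ∀ a {x v} → tenths (1 ℕ.+ a) ≤ v → v ≤ x + tenths 1 → tenths a ≤ x
  ≤-reading a {x} {v} a≤v v≤x+1 = begin
    tenths a                      ≡⟨ tenths-∸ 1 a ⟨
    tenths (1 ℕ.+ a) - tenths 1   ≤⟨ +-monoˡ-≤ _ (≤-trans a≤v v≤x+1) ⟩
    x + tenths 1 - tenths 1       ≡⟨ //-rightDividesʳ (tenths 1) x ⟩
    x                             ∎
    where open ≤-Reasoning

  reading-≤ : ∀ b {x v} → v ≤ tenths b → x - tenths 1 ≤ v → x ≤ tenths (b ℕ.+ 1)
  reading-≤ b {x} {v} v≤b x-1≤v = begin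
    x                          ≡⟨ //-rightDividesˡ (tenths 1) x ⟨
    x - tenths 1 + tenths 1    ≤⟨ +-monoˡ-≤ _ (≤-trans x-1≤v v≤b) ⟩
    tenths b + tenths 1        ≡⟨ tenths-+ b 1 ⟨
    tenths (b ℕ.+ 1)           ∎
    where open ≤-Reasoning

  x-y≤x+y : ∀ {x y} → 0# ≤ y → x - y ≤ x × x ≤ x + y
  x-y≤x+y {x} {y} 0≤y = lower , subst (_≤ x + y) (+-identityʳ x) (+-mono-≤ ≤-refl 0≤y)
    where
    lower : x - y ≤ x
    lower = subst (x - y ≤_) (//-rightDividesˡ y x)
              (subst (_≤ x - y + y) (+-identityʳ (x - y)) (+-mono-≤ ≤-refl 0≤y))

-- Invariant and progress of a single engine.

module Engine (𝓡 : CompleteOrderedField) (𝓝 : Names) (𝓥 : Vocabulary 𝓡 𝓝)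
              (κ : CompleteOrderedField.ℝ 𝓡)
              (κ-bounds : CompleteOrderedField._∈[_,_] 𝓡 κ
                            (CompleteOrderedField.tenths 𝓡 8) (CompleteOrderedField.tenths 𝓡 10))
              (ID : Calculus.Value 𝓡 𝓝) (cool : Names.𝒜 𝓝) (st : Names.𝒮 𝓝) where
  open CompleteOrderedField 𝓡
  open Calculus 𝓡 𝓝
  open Vocabulary 𝓥
  open CaseStudy 𝓡 𝓝 𝓥
  open OrderedField 𝓡

  controller : Process
  controller = Ctrl ID cool st

  -- Process variable `zero` stands for the inner recursion of `Cooling`, `suc zero` for the
  -- recursion of `Ctrl`.
  assessmentTerm : ∀ {m} → Proc (suc m) 2
  assessmentTerm =
    if (λ η → exceeds10 (η zero))
    then prefix (send warning (val ID) (pvar zero))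
    else prefix (write cool (val (real off)) (tick∙ pvar (suc zero)))

  -- This and `measurement` are spelled as the substitutions that unfolding `Ctrl` performs, so that
  -- targets of transitions match the indices of `Engine` by computation.
  regulation : Process
  regulation =
    fix (sub var (pvar zero ∷ (ren id suc ∘ (controller ∷ pvar)))
          (tick^ 5 (prefix (read st assessmentTerm))))

  measurement : Process
  measurement =
    prefix (read st (sub var (ren suc id ∘ (regulation ∷ controller ∷ pvar)) assessmentTerm))

  decision : Value → Process
  decision v =
    if (λ _ → exceeds10 v)
    then prefix (write cool (val (real on)) regulation)
    else (tick∙ controller)

  assessment : Value → Process
  assessment v =
    if (λ _ → exceeds10 v)
    then prefix (send warning (val ID) regulation)
    else prefix (write cool (val (real off)) (tick∙ controller))

  -- An inductive invariant of the engine with actuator value u and temperature t.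
  -- With k ticks of cooling to go, the bounds 2.9 + 1.4 k and 9.5 + 0.4 k come from
  -- cooling by at most 1.4 and at least 0.4 per tick.
  data Engine (u t : ℝ) : Process → Set where
    sensing    : 0# ≤ u → t ∈[ 0# , tenths 115 ] → Engine u t controller
    deciding   : ∀ {r} → 0# ≤ u → t ∈[ 0# , tenths 115 ] → r ∈[ t - ε , t + ε ] →
                 Engine u t (decision (real r))
    regulating : u < 0# → t ∈[ tenths 99 , tenths 115 ] → Engine u t regulation
    cooling    : ∀ k → k ℕ.≤ 4 → u < 0# →
                 t ∈[ tenths (k ℕ.* 14 ℕ.+ 29) , tenths (k ℕ.* 4 ℕ.+ 95) ] →
                 Engine u t (tick^ k measurement)
    assessing  : ∀ {r} → t ∈[ tenths 29 , tenths 95 ] → r ∈[ t - ε , t + ε ] →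
                 Engine u t (assessment (real r))
    resuming   : 0# ≤ u → t ∈[ tenths 29 , tenths 95 ] → Engine u t (tick∙ controller)

  -- Having no constructor for channel labels is what expresses that no warning is sent. A process
  -- may read any value, so `reads` promises the invariant only for reals within the sensor error.
  data Step (u t : ℝ) : Label → Process → Set where
    reads  : ∀ {v P} → (∀ {r} → v ≡ real r → r ∈[ t - ε , t + ε ] → Engine u t P) →
             Step u t (sens st v) P
    writes : ∀ {r P} → Engine r t P → Step u t (act cool (real r)) P

  engine-bounds : ∀ {u t P} → Engine u t P → t ∈[ 0# , tenths 115 ]
  engine-bounds (sensing _ b)              = b
  engine-bounds (deciding _ b _)           = b
  engine-bounds (regulating _ (l , h))     = ≤-trans (0≤tenths 99) l , h
  engine-bounds (cooling k k≤4 _ (l , h))  =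
    ≤-trans (0≤tenths (k ℕ.* 14 ℕ.+ 29)) l ,
    -- For `k` at most 4, the upper bound is at most 4 * 4 + 95 = 111.
    ≤-trans h (tenths-mono-≤ (ℕ.≤-trans (ℕ.+-monoˡ-≤ 95 (ℕ.*-monoˡ-≤ 4 k≤4)) (ℕ.m≤m+n 111 4)))
  engine-bounds (assessing (l , h) _)      =
    ≤-trans (0≤tenths 29) l , ≤-trans h (tenths-mono-≤ (ℕ.m≤m+n 95 20))
  engine-bounds (resuming _ (l , h))       =
    ≤-trans (0≤tenths 29) l , ≤-trans h (tenths-mono-≤ (ℕ.m≤m+n 95 20))

  exceeds10⇒tenths-100≤ : ∀ {r} → exceeds10 (real r) ≡ true → tenths 100 ≤ r
  exceeds10⇒tenths-100≤ {r} eq with fromℕ 10 <? r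
  ... | yes 10<r = subst (_≤ r) (sym (tenths-10* 10)) (<⇒≤ 10<r)

  ¬exceeds10⇒≤tenths-100 : ∀ {r} → exceeds10 (real r) ≡ false → r ≤ tenths 100
  ¬exceeds10⇒≤tenths-100 {r} eq with fromℕ 10 <? r
  ... | no 10≮r = subst (r ≤_) (sym (tenths-10* 10)) (≮⇒≥ 10≮r)

  -- The reading is at most 9.5 + 0.1 = 9.6. This excludes the branch that sends the warning.
  assessment-silent : ∀ {r t} → t ∈[ tenths 29 , tenths 95 ] → r ∈[ t - ε , t + ε ] →
                      exceeds10 (real r) ≡ false
  assessment-silent {r} {t} (_ , t≤95) (_ , r≤t+ε) = dec-false (fromℕ 10 <? r) (≤⇒≯ r≤10)
    where
    open ≤-Reasoning
    r≤10 : r ≤ fromℕ 10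
    r≤10 = begin
      r                      ≤⟨ r≤t+ε ⟩
      t + tenths 1           ≤⟨ +-monoˡ-≤ _ t≤95 ⟩
      tenths 95 + tenths 1   ≡⟨ tenths-+ 95 1 ⟨
      tenths 96              ≤⟨ tenths-mono-≤ (ℕ.m≤m+n 96 4) ⟩
      tenths 100             ≡⟨ tenths-10* 10 ⟩
      fromℕ 10               ∎

  assessment-contradiction : ∀ {A : Set} {r t} → t ∈[ tenths 29 , tenths 95 ] →
    r ∈[ t - ε , t + ε ] → exceeds10 (real r) ≡ true → A
  assessment-contradiction b m eq with trans (sym eq) (assessment-silent b m)
  ... | ()

  engine-step : ∀ {u t l P P′} → Engine u t P → P —[ l ]→ P′ → Step u t l P′
  engine-step (sensing off b) (rec (rec readp))      = reads λ { refl m → deciding off b m }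
  engine-step (deciding _ (_ , t≤115) (_ , r≤t+ε)) (ifT hot (rec writep)) =
    -- A reading above 10 forces a temperature of at least 10 - 0.1 = 9.9.
    writes (regulating on<0 (≤-reading 99 (exceeds10⇒tenths-100≤ hot) r≤t+ε , t≤115))
  engine-step (deciding _ _ _) (ifF _ ())
  engine-step (regulating _ _) (rec ())
  engine-step (cooling zero _ _ b) (rec readp)       = reads λ { refl m → assessing b m }
  engine-step (assessing b m) (ifT hot _)            = assessment-contradiction b m hot
  engine-step (assessing b _) (ifF _ (rec writep))   = writes (resuming 0≤off b)

  -- The condition of `evol` in `engineEnv`, stated on numbers; the joint evolution map yields it
  -- for each engine by computation.
  Evolves : ℝ → ℝ → ℝ → Set
  Evolves u t t′ =
    ∃ λ γ → γ ∈[ - δ , δ ] × t′ ≡ t + (ifᵇ does (u <? 0#) then - κ else 1#) + γ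

  evolves-off : ∀ b {u t t′} → 0# ≤ u → Evolves u t t′ →
                t ∈[ 0# , tenths b ] → t′ ∈[ 0# , tenths (b ℕ.+ 14) ]
  evolves-off b {u} 0≤u (γ , γ∈ , eq)
    rewrite dec-false (u <? 0#) (≤⇒≯ 0≤u) = heating-step b γ∈ eq

  evolves-on : ∀ a b {u t t′} → u < 0# → Evolves u t t′ →
               t ∈[ tenths (14 ℕ.+ a) , tenths (4 ℕ.+ b) ] → t′ ∈[ tenths a , tenths b ]
  evolves-on a b {u} u<0 (γ , γ∈ , eq)
    rewrite dec-true (u <? 0#) u<0 = cooling-step a b κ-bounds γ∈ eq

  -- What an engine inherits when the airplane has no `τ`-transition; it excludes timeouts of
  -- pending reads and writes. The reading `t` is taken because the exact temperature is always an
  -- admissible reading.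
  Patient : ℝ → Process → Set
  Patient t P = (∀ {P′} → ¬ (P —[ sens st (real t) ]→ P′)) ×
                (∀ {r P′} → ¬ (P —[ act cool (real r) ]→ P′))

  engine-tick : ∀ {u t t′ P P′} → Engine u t P → Patient t P → P —tick→ P′ →
                Evolves u t t′ → Engine u t′ P′
  engine-tick (sensing _ _) patient _ _ = ⊥-elim (proj₁ patient (rec (rec readp)))
  engine-tick (deciding _ _ _) patient (ifT hot _) _ =
    ⊥-elim (proj₂ patient (ifT hot (rec writep)))
  engine-tick (deciding off (0≤t , _) (t-ε≤r , _)) _ (ifF cold delay) e =
    -- The reading is at most 10, hence the temperature at most 10.1, and 10.1 + 1.4 = 11.5.
    sensing off (evolves-off 101 off e (0≤t , reading-≤ 100 (¬exceeds10⇒≤tenths-100 cold) t-ε≤r))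
  -- The first of the five ticks: 99 = 14 + 85 and 115 = 4 + 111, where 85 and 111 are the bounds
  -- for `k` = 4.
  engine-tick (regulating on b) _ (rec delay) e = cooling 4 ℕ.≤-refl on (evolves-on 85 111 on e b)
  engine-tick (cooling zero _ _ _) patient _ _ = ⊥-elim (proj₁ patient (rec readp))
  engine-tick (cooling (suc k) k<4 on b) _ delay e =
    -- `suc k ℕ.* 14 ℕ.+ 29` computes to `14 ℕ.+ (k ℕ.* 14 ℕ.+ 29)`, and likewise for 4 and 95.
    cooling k (ℕ.<⇒≤ k<4) on (evolves-on (k ℕ.* 14 ℕ.+ 29) (k ℕ.* 4 ℕ.+ 95) on e b)
  engine-tick (assessing b m) _ (ifT hot _) _ = assessment-contradiction b m hot
  engine-tick (assessing _ _) patient (ifF cold _) _ =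
    ⊥-elim (proj₂ patient (ifF cold (rec writep)))
  engine-tick (resuming off (l , h)) _ delay e
    with evolves-off 95 off e (≤-trans (0≤tenths 29) l , h)
  ... | l′ , h′ = sensing off (l′ , ≤-trans h′ (tenths-mono-≤ (ℕ.m≤m+n 109 6)))

  -- A finite run of exact readings and writes up to a process that can only tick. Its derivations
  -- are the termination measure in `settles⇒ticks`; the actuator value does not occur, so they
  -- survive writes.
  data Settles (t : ℝ) : Process → Set where
    ready   : ∀ {P P′} → P —tick→ P′ → (∀ {l Q} → ¬ (P —[ l ]→ Q)) → Settles t P
    reading : ∀ {P P′} → P —[ sens st (real t) ]→ P′ → Settles t P′ → Settles t P
    writing : ∀ {P P′ r} → P —[ act cool (real r) ]→ P′ → Settles t P′ → Settles t P

  settles-regulation : ∀ {t} → Settles t regulation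
  settles-regulation = ready (rec delay) λ { (rec ()) }

  settles-decision : ∀ {t} r → Settles t (decision (real r))
  settles-decision r with exceeds10 (real r)
  ... | true  = writing (ifT refl (rec writep)) settles-regulation
  ... | false = ready (ifF refl delay) λ { (ifF _ ()) }

  settles-assessment : ∀ {t} r → exceeds10 (real r) ≡ false → Settles t (assessment (real r))
  settles-assessment r cold = writing (ifF cold (rec writep)) (ready delay λ ())

  t∈reading : ∀ t → t ∈[ t - ε , t + ε ]
  t∈reading t = x-y≤x+y (0≤tenths 1)

  engine-settles : ∀ {u t P} → Engine u t P → Settles t P
  engine-settles {t = t} (sensing _ _)    = reading (rec (rec readp)) (settles-decision t)
  engine-settles (deciding {r} _ _ _)     = settles-decision r
  engine-settles (regulating _ _)         = settles-regulation
  engine-settles {t = t} (cooling zero _ _ b) =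
    reading (rec readp) (settles-assessment t (assessment-silent b (t∈reading t)))
  engine-settles (cooling (suc k) _ _ _)  = ready delay λ ()
  engine-settles (assessing {r} b m)      = settles-assessment r (assessment-silent b m)
  engine-settles (resuming _ _)           = ready delay λ ()

-- Two engines in parallel with `Check`.

module Bisimulation (𝓡 : CompleteOrderedField) (𝓝 : Names) (𝓥 : Vocabulary 𝓡 𝓝) where
  open CompleteOrderedField 𝓡
  open Names 𝓝
  open Calculus 𝓡 𝓝
  open Vocabulary 𝓥
  open CaseStudy 𝓡 𝓝 𝓥
  open OrderedField 𝓡

  X̂ : Pred 𝒳 0ℓ
  X̂ = ｛ temp-l ｝ ∪ ｛ temp-r ｝

  Â : Pred 𝒜 0ℓ
  Â = ｛ cool-l ｝ ∪ ｛ cool-r ｝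

  Ŝ : Pred 𝒮 0ℓ
  Ŝ = ｛ st-l ｝ ∪ ｛ st-r ｝

  -- Transitions alter only `ξx` and `ξu`, so these and the cooling rate determine the environment.
  planeEnv : ℝ → ℝ^ X̂ → ℝ^ Â → Env X̂ Â Ŝ
  planeEnv κ x u = record (CPS.env (union (engine κ L temp-l cool-l st-l)
                                          (engine κ R temp-r cool-r st-r) engines-disjoint))
    { ξx = x ; ξu = u }

  -- `Check` stays fixed: it waits for a warning, none comes, and its timeout leads back to `Check`.
  planeProc : Process → Process → Process
  planeProc P Q = (P ∥ Q) ∥ Check ∖ warning

  plane : ℝ → ℝ^ X̂ → ℝ^ Â → Process → Process → CPS
  plane κ x u P Q = planeEnv κ x u ⋈ planeProc P Q

  tl tr : ℝ^ X̂ → ℝ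
  tl x = x temp-l (inj₁ refl)
  tr x = x temp-r (inj₂ refl)

  ul ur : ℝ^ Â → ℝ
  ul u = u cool-l (inj₁ refl)
  ur u = u cool-r (inj₂ refl)

  _[_↦_] : ℝ^ Â → 𝒜 → ℝ → ℝ^ Â
  (u [ a ↦ r ]) b b∈Â = ifᵇ does (b ≟𝒜 a) then r else u b b∈Â

  updated : ∀ u a r b∈Â → (u [ a ↦ r ]) a b∈Â ≡ r
  updated u a r b∈Â rewrite dec-true (a ≟𝒜 a) refl = refl

  unchanged : ∀ u {a b} r b∈Â → b ≢ a → (u [ a ↦ r ]) b b∈Â ≡ u b b∈Â
  unchanged u {a} {b} r b∈Â b≢a rewrite dec-false (b ≟𝒜 a) b≢a = refl

  module _ (κ : ℝ) (κ-bounds : κ ∈[ tenths 8 , tenths 10 ]) where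

    module Left  = Engine 𝓡 𝓝 𝓥 κ κ-bounds L cool-l st-l
    module Right = Engine 𝓡 𝓝 𝓥 κ κ-bounds R cool-r st-r

    -- An inductive invariant, closed under transitions by `step-reachable` and `tick-reachable`.
    data Reachable : CPS → Set₁ where
      reachable : ∀ {x u P Q} → Left.Engine (ul u) (tl x) P → Right.Engine (ur u) (tr x) Q →
                  Reachable (plane κ x u P Q)

    data PlaneStep (uˡ tˡ uʳ tʳ : ℝ) (P Q : Process) : Label → Process → Set where
      left  : ∀ {l P′} → Left.Step uˡ tˡ l P′ → PlaneStep uˡ tˡ uʳ tʳ P Q l (planeProc P′ Q)
      right : ∀ {l Q′} → Right.Step uʳ tʳ l Q′ → PlaneStep uˡ tˡ uʳ tʳ P Q l (planeProc P Q′)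

    -- Synchronisation would need an engine to act on a channel, which `engine-step` excludes, and
    -- the only input of `Check` is on the restricted channel.
    plane-step : ∀ {uˡ tˡ uʳ tʳ P Q l R} → Left.Engine uˡ tˡ P → Right.Engine uʳ tʳ Q →
                 planeProc P Q —[ l ]→ R → PlaneStep uˡ tˡ uʳ tʳ P Q l R
    plane-step p q (res (parˡ (parˡ d)) _)   = left (Left.engine-step p d)
    plane-step p q (res (parˡ (parʳ d)) _)   = right (Right.engine-step q d)
    plane-step p q (res (parˡ (comˡ d _)) _) with () ← Left.engine-step p d
    plane-step p q (res (parˡ (comʳ d _)) _) with () ← Left.engine-step p d
    plane-step p q (res (parʳ (rec inpp)) c≢) = ⊥-elim (c≢ refl)
    plane-step p q (res (comˡ (parˡ d) _) _) with () ← Left.engine-step p d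
    plane-step p q (res (comˡ (parʳ d) _) _) with () ← Right.engine-step q d
    plane-step p q (res (comʳ (parˡ d) _) _) with () ← Left.engine-step p d
    plane-step p q (res (comʳ (parʳ d) _) _) with () ← Right.engine-step q d

    measuredˡ : ∀ {x u r} → r ∈ read-sensor (planeEnv κ x u) st-l → r ∈[ tl x - ε , tl x + ε ]
    measuredˡ (_ , (_ , _ , m , _ , refl) , inj₁ refl , refl) = m
    measuredˡ (_ , _ , inj₂ r≡l , _) = ⊥-elim (st-l≢st-r (sym r≡l))

    measuredʳ : ∀ {x u r} → r ∈ read-sensor (planeEnv κ x u) st-r → r ∈[ tr x - ε , tr x + ε ]
    measuredʳ (_ , (_ , _ , _ , m , refl) , inj₂ refl , refl) = m
    measuredʳ (_ , _ , inj₁ l≡r , _) = ⊥-elim (st-l≢st-r l≡r)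

    writeˡ : ∀ x u {r P Q} → Left.Engine r (tl x) P → Right.Engine (ur u) (tr x) Q →
             Reachable (plane κ x (u [ cool-l ↦ r ]) P Q)
    writeˡ x u {r} p q = reachable {x = x}
      (subst (λ v → Left.Engine v _ _) (sym (updated u cool-l r _)) p)
      (subst (λ v → Right.Engine v _ _) (sym (unchanged u r _ (cool-l≢cool-r ∘ sym))) q)

    writeʳ : ∀ x u {r P Q} → Left.Engine (ul u) (tl x) P → Right.Engine r (tr x) Q →
             Reachable (plane κ x (u [ cool-r ↦ r ]) P Q)
    writeʳ x u {r} p q = reachable {x = x}
      (subst (λ v → Left.Engine v _ _) (sym (unchanged u r _ cool-l≢cool-r)) p)
      (subst (λ v → Right.Engine v _ _) (sym (updated u cool-r r _)) q)

    step-reachable : ∀ {M M′ α} → Reachable M → M —⟨ α ⟩→₀ M′ → α ≡ τ × Reachable M′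
    step-reachable (reachable p q) (Out _ d) with plane-step p q d
    ... | left ()
    ... | right ()
    step-reachable (reachable p q) (Inp _ d) with plane-step p q d
    ... | left ()
    ... | right ()
    step-reachable (reachable p q) (Tau _ d) with plane-step p q d
    ... | left ()
    ... | right ()
    step-reachable (reachable {x} {u} p q) (SensRead _ d m) with plane-step p q d
    ... | left (Left.reads f)   = refl , reachable {x} {u} (f refl (measuredˡ {x} {u} m)) q
    ... | right (Right.reads f) = refl , reachable {x} {u} p (f refl (measuredʳ {x} {u} m))
    step-reachable (reachable {x} {u} p q) (ActWrite _ d) with plane-step p q d
    ... | left (Left.writes p′)   = refl , writeˡ x u p′ q
    ... | right (Right.writes q′) = refl , writeʳ x u p q′

    -- Available moves and progress to a tick.

    Safe : ℝ^ X̂ → Set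
    Safe x = tl x ∈[ 0# , tenths 115 ] × tr x ∈[ 0# , tenths 115 ]

    safe-invariant : ∀ x u → Safe x → Invariant (planeEnv κ x u)
    safe-invariant _ _ (bˡ , bʳ) = cong₂ _∧_ (in-range bˡ) (in-range bʳ)
      where
      in-range : ∀ {t} → t ∈[ 0# , tenths 115 ] → does (0# ≤? t) ∧ does (t ≤? fromℕ 30) ≡ true
      in-range {t} (0≤t , t≤115) = cong₂ _∧_ (dec-true (0# ≤? t) 0≤t)
        (dec-true (t ≤? fromℕ 30)
          (≤-trans t≤115 (subst (tenths 115 ≤_) (tenths-10* 30) (tenths-mono-≤ (ℕ.m≤m+n 115 185)))))

    true-readings : ∀ x u s s∈Ŝ →
                    [ (λ _ → tl x) , (λ _ → tr x) ] s∈Ŝ ∈ read-sensor (planeEnv κ x u) s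
    true-readings x u s s∈Ŝ =
      _ , ((λ _ _ → tl x) , (λ _ _ → tr x) , Left.t∈reading (tl x) , Left.t∈reading (tr x) , refl) ,
      s∈Ŝ , refl

    module _ {x} (safe : Safe x) (u : ℝ^ Â) {P Q : Process} where

      readˡ : ∀ {P′} → P —[ sens st-l (real (tl x)) ]→ P′ →
              plane κ x u P Q —⟨ τ ⟩→₀ plane κ x u P′ Q
      readˡ d = SensRead (safe-invariant x u safe) (res (parˡ (parˡ d)) λ ())
                  (true-readings x u _ (inj₁ refl))

      readʳ : ∀ {Q′} → Q —[ sens st-r (real (tr x)) ]→ Q′ →
              plane κ x u P Q —⟨ τ ⟩→₀ plane κ x u P Q′
      readʳ d = SensRead (safe-invariant x u safe) (res (parˡ (parʳ d)) λ ())
                  (true-readings x u _ (inj₂ refl))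

      actˡ : ∀ {r P′} → P —[ act cool-l (real r) ]→ P′ →
             plane κ x u P Q —⟨ τ ⟩→₀ plane κ x (u [ cool-l ↦ r ]) P′ Q
      actˡ d = ActWrite (safe-invariant x u safe) (res (parˡ (parˡ d)) λ ())

      actʳ : ∀ {r Q′} → Q —[ act cool-r (real r) ]→ Q′ →
             plane κ x u P Q —⟨ τ ⟩→₀ plane κ x (u [ cool-r ↦ r ]) P Q′
      actʳ d = ActWrite (safe-invariant x u safe) (res (parˡ (parʳ d)) λ ())

      tick-ready : ∀ {P′ Q′} → P —tick→ P′ → Q —tick→ Q′ →
                   (∀ {l R} → ¬ (P —[ l ]→ R)) → (∀ {l R} → ¬ (Q —[ l ]→ R)) →
                   ∃ λ M′ → plane κ x u P Q —⟨ tick ⟩→ M′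
      tick-ready d e ¬P→ ¬Q→ =
        _ , Time (safe-invariant x u safe)
              (res (par (par d e (λ _ → engines-silent)) (rec timeout)
                        (λ { _ (parˡ f) → engines-silent f
                           ; _ (parʳ (rec ()))
                           ; _ (comˡ f _) → engines-silent f
                           ; _ (comʳ f _) → engines-silent f })))
              (λ { _ (SensRead _ f _) → silent f
                 ; _ (ActWrite _ f)   → silent f
                 ; _ (Tau _ f)        → silent f })
              (_ , ((λ _ _ → tˡ) , (λ _ _ → tʳ) , (δ , δ∈ , refl) , (δ , δ∈ , refl) , refl) , refl)
        where
        engines-silent : ∀ {l R} → ¬ (P ∥ Q —[ l ]→ R)
        engines-silent (parˡ f)   = ¬P→ f
        engines-silent (parʳ f)   = ¬Q→ f
        engines-silent (comˡ f _) = ¬P→ f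
        engines-silent (comʳ f _) = ¬P→ f
        silent : ∀ {l R} → ¬ (planeProc P Q —[ l ]→ R)
        silent (res (parˡ f) _)          = engines-silent f
        silent (res (parʳ (rec inpp)) c≢) = c≢ refl
        silent (res (comˡ f _) _)        = engines-silent f
        silent (res (comʳ f _) _)        = engines-silent f
        -- The noise `δ` in both engines is a witness that a next state exists. `heat` looks at its
        -- function at one actuator only, so a constant function can replace the restriction of `u`.
        tˡ tʳ : ℝ
        tˡ = tl x + heat κ cool-l (λ { _ refl → ul u }) + δ
        tʳ = tr x + heat κ cool-r (λ { _ refl → ur u }) + δ
        δ∈ : δ ∈[ - δ , δ ]
        δ∈ = ≤-trans (subst (_≤ 0#) (+-identityˡ (- δ)) (proj₁ (x-y≤x+y (0≤tenths 4))))
                     (0≤tenths 4) , ≤-refl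

    tick-reachable : ∀ {M M′} → Reachable M → M —⟨ tick ⟩→ M′ → Reachable M′
    tick-reachable (reachable {x} {u} p q)
      (Time _ (res (par (par d e _) (rec timeout) _)) stuck
            (_ , (_ , _ , evolˡ , evolʳ , refl) , refl)) =
      reachable
        -- A possible exact reading or write would be a `τ`-transition of the airplane, against
        -- `stuck`.
        (Left.engine-tick p ((λ f → stuck _ (readˡ safe u f)) , λ f → stuck _ (actˡ safe u f))
                          d evolˡ)
        (Right.engine-tick q ((λ f → stuck _ (readʳ safe u f)) , λ f → stuck _ (actʳ safe u f))
                           e evolʳ)
      where
      safe : Safe x
      safe = Left.engine-bounds p , Right.engine-bounds q

    ⇒-reachable : ∀ {M M′} → Reachable M → M ⇒ M′ → Reachable M′
    ⇒-reachable m ε*            = m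
    ⇒-reachable m (inst d ◅ ds) = ⇒-reachable (proj₂ (step-reachable m d)) ds

    ⇒tick-reachable : ∀ {M M′} → Reachable M → M ⇒⟨ tick ⟩ M′ → Reachable M′
    ⇒tick-reachable m (_ , _ , ds , t , ds′) = ⇒-reachable (tick-reachable (⇒-reachable m ds) t) ds′

    τ-prepend : ∀ {M M′} → M —⟨ τ ⟩→₀ M′ →
                (∃ λ N → M′ ⇒⟨ tick ⟩ N) → ∃ λ N → M ⇒⟨ tick ⟩ N
    τ-prepend d (_ , _ , _ , ds , rest) = _ , _ , _ , inst d ◅ ds , rest

    module _ {x : ℝ^ X̂} (safe : Safe x) where

      -- The left engine settles first, then the right one. Reads and writes keep the temperatures,
      -- so `safe` persists while `u` changes.
      settles⇒ticks : ∀ u {P Q} → Left.Settles (tl x) P → Right.Settles (tr x) Q →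
                      ∃ λ N → plane κ x u P Q ⇒⟨ tick ⟩ N
      settles⇒ticks u (Left.reading d s) s′ =
        τ-prepend (readˡ safe u d) (settles⇒ticks u s s′)
      settles⇒ticks u (Left.writing {r = r} d s) s′ =
        τ-prepend (actˡ safe u d) (settles⇒ticks (u [ cool-l ↦ r ]) s s′)
      settles⇒ticks u s@(Left.ready _ _) (Right.reading e s′) =
        τ-prepend (readʳ safe u e) (settles⇒ticks u s s′)
      settles⇒ticks u s@(Left.ready _ _) (Right.writing {r = r} e s′) =
        τ-prepend (actʳ safe u e) (settles⇒ticks (u [ cool-r ↦ r ]) s s′)
      settles⇒ticks u (Left.ready d ¬P→) (Right.ready e ¬Q→) =
        let _ , t = tick-ready safe u d e ¬P→ ¬Q→ in _ , _ , _ , ε* , t , ε*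

    reachable-ticks : ∀ {M} → Reachable M → ∃ λ N → M ⇒⟨ tick ⟩ N
    reachable-ticks (reachable {u = u} p q) =
      settles⇒ticks (Left.engine-bounds p , Right.engine-bounds q) u
                    (Left.engine-settles p) (Right.engine-settles q)

    initial : Reachable (plane κ (λ _ → [ (λ _ → 0#) , (λ _ → 0#) ])
                                 (λ _ → [ (λ _ → off) , (λ _ → off) ])
                                 (Ctrl L cool-l st-l) (Ctrl R cool-r st-r))
    initial = reachable (Left.sensing 0≤off 0∈) (Right.sensing 0≤off 0∈)
      where
      0∈ : 0# ∈[ 0# , tenths 115 ]
      0∈ = ≤-refl , 0≤tenths 115

  -- The bisimulation.

  Flying : CPS → Set₁
  Flying M = ∃₂ λ κ κ-bounds → Reachable κ κ-bounds M

  BothFlying : CPS → CPS → Set₁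
  BothFlying M N = Flying M × Flying N

  -- The cooling rate is hidden in `Flying`, so successors remain related whatever their
  -- temperatures and processes are.
  bothFlying-isBisimulation : IsBisimulation BothFlying
  bothFlying-isBisimulation = record { symmetric = λ (m , n) → n , m ; simulates = simulates }
    where
    simulates : ∀ {M N M′ α} → BothFlying M N → M —⟨ α ⟩→ M′ →
                ∃ λ N′ → N ⇛⟨ α ⟩ N′ × BothFlying M′ N′
    -- The action must be `τ`, and the other airplane answers by staying put.
    simulates ((κ , b , m) , n) (inst d) with refl , m′ ← step-reachable κ b m d =
      _ , ε* , (κ , b , m′) , n
    simulates ((κ , b , m) , (κ′ , b′ , n)) d@(Time _ _ _ _)
      with _ , ds ← reachable-ticks κ′ b′ n =
      _ , ds , (κ , b , tick-reachable κ b m d) , (κ′ , b′ , ⇒tick-reachable κ′ b′ n ds)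

  airplane≈airplaneBar : Airplane ≈ AirplaneBar
  airplane≈airplaneBar =
    BothFlying , bothFlying-isBisimulation ,
    -- `Airplane` has the rate 1 and `AirplaneBar` the rate 0.8, the two ends of the interval.
    (_ , (subst (tenths 8 ≤_) tenths-10 (tenths-mono-≤ (ℕ.m≤m+n 8 2)) , inj₂ (sym tenths-10)) ,
     initial _ _) ,
    (_ , (≤-refl , tenths-mono-≤ (ℕ.m≤m+n 8 2)) , initial _ _)

proposition14 : (𝓡 : CompleteOrderedField) (𝓝 : Names) (𝓥 : Vocabulary 𝓡 𝓝) →
    let open Calculus 𝓡 𝓝
        open CaseStudy 𝓡 𝓝 𝓥
    in Airplane ≈ AirplaneBar
proposition14 = Bisimulation.airplane≈airplaneBar
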